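{- Let $q=p^r$ be a power of a prime $p$, let $1\le e\le r$, $l=p^e$, $t=q/l$, let $\mathbb{F}_q=\{c_0,\dots,c_{q-1}\}$, and let $\Sigma_q$ be the group of permutations of $\mathbb{F}_q$. Let $$\alpha=C_{0,\alpha}\cdots C_{t-1,\alpha},\qquad \beta=C_{0,\beta}\cdots C_{l-1,\beta}$$ be the products of disjoint cycles given by $C_{i,\alpha}=(c_{il},c_{1+il},\dots,c_{(l-1)+il})$ for $0\le i\le t-1$, and $C_{j,\beta}=(c_{j},c_{j+l},\dots,c_{j+(t-1)l})$ for $0\le j\le l-1$. Then the set $$G=\{\alpha^i\beta^j : 0\le i\le l-1,\ 0\le j\le t-1\}$$ is a subgroup of $\Sigma_q$ without fixed points, and it has order $|G|=q$.
   Context: The elements of $\mathbb{F}_q$ are enumerated in an arbitrary fixed way as $c_0,\dots,c_{q-1}$. A cycle $(a_1,a_2,\dots,a_k)$ sends $a_1\mapsto a_2\mapsto\cdots\mapsto a_k\mapsto a_1$ and fixes everything else; a cycle of length $1$ is the identity. A subgroup of $\Sigma_q$ is "without fixed points" if none of its elements other than the identity has a fixed point. -}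

module Defs where

open import Algebra.Apartness.Bundles using (HeytingField)
open import Algebra.Bundles using (Group)
import Algebra.Definitions.RawMonoid as RawMonoidDefinitions
open import Data.Fin.Base using (Fin; toℕ; fromℕ<)
open import Data.Fin.Properties
  using (any?; toℕ<n; toℕ-injective; toℕ-fromℕ<; fromℕ<-injective)
import Data.Fin.Properties as Fin
open import Data.Nat.Base
  using (ℕ; suc; _+_; _*_; _∸_; _≤_; _<_; NonZero)
import Data.Nat.Base as ℕ
open import Data.Nat.Divisibility using (_∣_; ∣m⇒∣m*n; ∣-refl)
open import Data.Nat.DivMod using (_/_; _%_; _mod_; m%n<n; m<n⇒m%n≡m;
  %-distribˡ-+; m%n%n≡m%n; [m+n]%n≡m%n; m/n*n≡m)
open import Data.Nat.Primality using (Prime; prime⇒nonZero)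
open import Data.Nat.Properties
  using (+-monoˡ-<; *-monoˡ-≤; <-≤-trans; +-cancelʳ-≡; +-cancelˡ-≡;
         *-cancelʳ-≡; m^n≢0; ^-distribˡ-+-*; m+[n∸m]≡n; +-comm; +-suc)
open import Data.Product.Base using (Σ; ∃-syntax; _×_; _,_; proj₁)
open import Data.Vec.Functional using (Vector)
open import Function.Bundles using (Inverse)
import Function.Construct.Composition as Composition
import Function.Construct.Identity as Identity
import Function.Construct.Symmetry as Symmetry
open import Level using (Level; _⊔_)
open import Relation.Binary.Bundles using (Setoid)
import Relation.Binary.Construct.On as On
open import Relation.Binary.Definitions using (Decidable; _Respects_)
open import Relation.Binary.PropositionalEquality as ≡ using (_≡_)
open import Relation.Nullary using (¬_; yes; no; contradiction)
open import Relation.Nullary.Decidable using (map′)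
open import Relation.Unary using (Pred; _∈_)

private
  variable
    a ℓ ℓ₁ ℓ₂ : Level

------------------------------------------------------------------------
-- Subgroups, orders, powers and products

module _ (G : Group a ℓ) where
  open Group G

  record IsSubgroup {p} (H : Pred Carrier p) : Set (a ⊔ ℓ ⊔ p) where
    field
      ∈-resp-≈  : H Respects _≈_
      ε-closed  : ε ∈ H
      ∙-closed  : ∀ {x y} → x ∈ H → y ∈ H → x ∙ y ∈ H
      ⁻¹-closed : ∀ {x} → x ∈ H → x ⁻¹ ∈ H

  subsetSetoid : ∀ {p} → Pred Carrier p → Setoid (a ⊔ p) ℓ
  subsetSetoid H = On.setoid {B = Σ Carrier H} setoid proj₁

  HasOrder : ∀ {p} → Pred Carrier p → ℕ → Set (a ⊔ ℓ ⊔ p)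
  HasOrder H n = Inverse (≡.setoid (Fin n)) (subsetSetoid H)

  open RawMonoidDefinitions rawMonoid using () renaming (_×_ to multiple; sum to fold)

  power : Carrier → ℕ → Carrier
  power x n = multiple n x

  -- x₀ ∙ x₁ ∙ ⋯ ∙ xₙ₋₁
  product : ∀ {n} → Vector Carrier n → Carrier
  product = fold

------------------------------------------------------------------------
-- The symmetric group, with π ∙ ρ acting as x ↦ π (ρ x)

module _ (S : Setoid a ℓ) where
  open Setoid S
  open Inverse using (to; from; to-cong; from-cong; inverseˡ; inverseʳ)

  Symmetric : Group (a ⊔ ℓ) (a ⊔ ℓ)
  Symmetric = record
    { Carrier = Inverse S S
    ; _≈_     = λ π ρ → ∀ x → to π x ≈ to ρ x
    ; _∙_     = λ π ρ → Composition.inverse ρ π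
    ; ε       = Identity.inverse S
    ; _⁻¹     = Symmetry.inverse
    ; isGroup = record
      { isMonoid = record
        { isSemigroup = record
          { isMagma = record
            { isEquivalence = record
              { refl  = λ _ → refl
              ; sym   = λ π≈ρ x → sym (π≈ρ x)
              ; trans = λ π≈ρ ρ≈σ x → trans (π≈ρ x) (ρ≈σ x)
              }
            ; ∙-cong = λ {π} {_} {_} {σ} π≈π′ σ≈σ′ x →
                trans (to-cong π (σ≈σ′ x)) (π≈π′ _)
            }
          ; assoc = λ _ _ _ _ → refl
          }
        ; identity = (λ _ _ → refl) , (λ _ _ → refl)
        }
      ; inverse = (λ π _ → inverseʳ π refl) , (λ π _ → inverseˡ π refl)
      ; ⁻¹-cong = λ {π} {ρ} π≈ρ x →
          inverseʳ π (sym (trans (π≈ρ _) (inverseˡ ρ refl)))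
      }
    }

  WithoutFixedPoints : ∀ {p} → Pred (Inverse S S) p → Set (a ⊔ ℓ ⊔ p)
  WithoutFixedPoints H =
    ∀ {π} → π ∈ H → ¬ Group._≈_ Symmetric π (Group.ε Symmetric) →
    ¬ (∃[ x ] to π x ≈ x)

------------------------------------------------------------------------
-- Cycles

next : ∀ {k} → Fin k → Fin k
next {suc n} i = suc (toℕ i) mod suc n

prev : ∀ {k} → Fin k → Fin k
prev {suc n} i = (n + toℕ i) mod suc n

absorbˡ : ∀ x y n .{{_ : NonZero n}} → (x + y % n) % n ≡ (x + y) % n
absorbˡ x y n = begin
  (x + y % n) % n             ≡⟨ %-distribˡ-+ x (y % n) n ⟩
  (x % n + y % n % n) % n     ≡⟨ ≡.cong (λ z → (x % n + z) % n) (m%n%n≡m%n y n) ⟩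
  (x % n + y % n) % n         ≡⟨ %-distribˡ-+ x y n ⟨
  (x + y) % n                 ∎
  where open ≡.≡-Reasoning

toℕ-mod : ∀ m n .{{_ : NonZero n}} → toℕ (m mod n) ≡ m % n
toℕ-mod m n = toℕ-fromℕ< (m%n<n m n)

wrap : ∀ {n} (i : Fin (suc n)) → (suc n + toℕ i) % suc n ≡ toℕ i
wrap {n} i = begin
  (suc n + toℕ i) % suc n   ≡⟨ ≡.cong (_% suc n) (+-comm (suc n) (toℕ i)) ⟩
  (toℕ i + suc n) % suc n   ≡⟨ [m+n]%n≡m%n (toℕ i) (suc n) ⟩
  toℕ i % suc n             ≡⟨ m<n⇒m%n≡m (toℕ<n i) ⟩
  toℕ i                     ∎
  where open ≡.≡-Reasoning

next-prev : ∀ {k} (i : Fin k) → next (prev i) ≡ i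
next-prev {suc n} i = toℕ-injective (begin
  toℕ (next (prev i))                 ≡⟨ toℕ-mod (suc (toℕ (prev i))) (suc n) ⟩
  suc (toℕ (prev i)) % suc n          ≡⟨ ≡.cong (λ z → suc z % suc n) (toℕ-mod (n + toℕ i) (suc n)) ⟩
  (1 + (n + toℕ i) % suc n) % suc n   ≡⟨ absorbˡ 1 (n + toℕ i) (suc n) ⟩
  (suc n + toℕ i) % suc n             ≡⟨ wrap i ⟩
  toℕ i                               ∎)
  where open ≡.≡-Reasoning

prev-next : ∀ {k} (i : Fin k) → prev (next i) ≡ i
prev-next {suc n} i = toℕ-injective (begin
  toℕ (prev (next i))                 ≡⟨ toℕ-mod (n + toℕ (next i)) (suc n) ⟩
  (n + toℕ (next i)) % suc n          ≡⟨ ≡.cong (λ z → (n + z) % suc n) (toℕ-mod (suc (toℕ i)) (suc n)) ⟩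
  (n + suc (toℕ i) % suc n) % suc n   ≡⟨ absorbˡ n (suc (toℕ i)) (suc n) ⟩
  (n + suc (toℕ i)) % suc n           ≡⟨ ≡.cong (_% suc n) (+-suc n (toℕ i)) ⟩
  (suc n + toℕ i) % suc n             ≡⟨ wrap i ⟩
  toℕ i                               ∎)
  where open ≡.≡-Reasoning

module Cycle (S : Setoid a ℓ) (_≟_ : Decidable (Setoid._≈_ S)) where
  open Setoid S

  Distinct : ∀ {k} → Vector Carrier k → Set ℓ
  Distinct u = ∀ {i j} → u i ≈ u j → i ≡ j

  module _ {k} (u : Vector Carrier k) where

    -- Sends uᵢ to u₍ₛ ᵢ₎ and fixes everything else.
    shift : (Fin k → Fin k) → Carrier → Carrier
    shift s x with any? (λ i → u i ≟ x)
    ... | yes (i , _) = u (s i)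
    ... | no _        = x

    module _ (distinct : Distinct u) where

      shift-entry : ∀ s i {x} → u i ≈ x → shift s x ≈ u (s i)
      shift-entry s i {x} uᵢ≈x with any? (λ j → u j ≟ x)
      ... | yes (j , uⱼ≈x) =
        reflexive (≡.cong (λ z → u (s z)) (distinct (trans uⱼ≈x (sym uᵢ≈x))))
      ... | no ∄i = contradiction (i , uᵢ≈x) ∄i

      shift-other : ∀ s {x} → ¬ (∃[ i ] u i ≈ x) → shift s x ≈ x
      shift-other s {x} ∄i with any? (λ j → u j ≟ x)
      ... | yes ∃i = contradiction ∃i ∄i
      ... | no _   = refl

      shift-cong : ∀ s {x y} → x ≈ y → shift s x ≈ shift s y
      shift-cong s {x} {y} x≈y with any? (λ j → u j ≟ x)
      ... | yes (i , uᵢ≈x) = sym (shift-entry s i (trans uᵢ≈x x≈y))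
      ... | no ∄i =
        trans x≈y (sym (shift-other s λ (i , uᵢ≈y) → ∄i (i , trans uᵢ≈y (sym x≈y))))

      shift-inverse : ∀ s s′ → (∀ i → s (s′ i) ≡ i) →
                      ∀ x → shift s (shift s′ x) ≈ x
      shift-inverse s s′ ss′≡id x with any? (λ j → u j ≟ x)
      ... | yes (i , uᵢ≈x) =
        trans (shift-entry s (s′ i) refl)
              (trans (reflexive (≡.cong u (ss′≡id i))) uᵢ≈x)
      ... | no ∄i = shift-other s ∄i

  -- The cycle (u₀, u₁, …, uₖ₋₁).
  cycle : ∀ {k} (u : Vector Carrier k) → Distinct u → Inverse S S
  cycle u distinct = record
    { to        = shift u next
    ; from      = shift u prev
    ; to-cong   = shift-cong u distinct next
    ; from-cong = shift-cong u distinct prev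
    ; inverse   =
        (λ x≈ → trans (shift-cong u distinct next x≈) (shift-inverse u distinct next prev next-prev _))
      , (λ x≈ → trans (shift-cong u distinct prev x≈) (shift-inverse u distinct prev next prev-next _))
    }

------------------------------------------------------------------------
-- Finite fields

fieldSetoid : HeytingField a ℓ₁ ℓ₂ → Setoid a ℓ₁
fieldSetoid F = record { isEquivalence = HeytingField.isEquivalence F }

-- Over a field with finitely many enumerated elements equality is
-- decidable, so a Heyting field of this kind is a field in the usual sense.
Enumeration : HeytingField a ℓ₁ ℓ₂ → ℕ → Set (a ⊔ ℓ₁)
Enumeration F q = Inverse (≡.setoid (Fin q)) (fieldSetoid F)

module Construction
  (F : HeytingField a ℓ₁ ℓ₂) {p r e : ℕ} (p-prime : Prime p) (e≤r : e ≤ r)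
  (enumeration : Enumeration F (p ℕ.^ r))
  where

  open HeytingField F using (Carrier; _≈_; sym; trans)
  open Inverse enumeration using () renaming
    ( to to c; from to index; to-cong to c-cong; from-cong to index-cong
    ; strictlyInverseˡ to c-index; strictlyInverseʳ to index-c)

  Σ-q : Group (a ⊔ ℓ₁) (a ⊔ ℓ₁)
  Σ-q = Symmetric (fieldSetoid F)

  q l : ℕ
  q = p ℕ.^ r
  l = p ℕ.^ e

  instance
    l-nonZero : NonZero l
    l-nonZero = m^n≢0 p e {{prime⇒nonZero p-prime}}

  t : ℕ
  t = q / l

  t*l≡q : t * l ≡ q
  t*l≡q = m/n*n≡m (≡.subst (l ∣_)
    (≡.trans (≡.sym (^-distribˡ-+-* p e (r ∸ e))) (≡.cong (p ℕ.^_) (m+[n∸m]≡n e≤r)))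
    (∣m⇒∣m*n (p ℕ.^ (r ∸ e)) ∣-refl))

  position< : (m : Fin l) (n : Fin t) → toℕ m + toℕ n * l < q
  position< m n = <-≤-trans (+-monoˡ-< (toℕ n * l) (toℕ<n m))
    (≡.subst (suc (toℕ n) * l ≤_) t*l≡q (*-monoˡ-≤ l (toℕ<n n)))

  entry : Fin l → Fin t → Carrier
  entry m n = c (fromℕ< (position< m n))

  _≟_ : Decidable _≈_
  x ≟ y = map′
    (λ eq → trans (sym (c-index x)) (trans (c-cong eq) (c-index y)))
    index-cong (index x Fin.≟ index y)

  open Cycle (fieldSetoid F) _≟_

  position-≡ : ∀ m n m′ n′ → entry m n ≈ entry m′ n′ →
               toℕ m + toℕ n * l ≡ toℕ m′ + toℕ n′ * l
  position-≡ m n m′ n′ eq =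
    fromℕ<-injective _ _ (position< m n) (position< m′ n′)
      (≡.trans (≡.sym (index-c _)) (≡.trans (index-cong eq) (index-c _)))

  distinctα : ∀ i → Distinct (λ m → entry m i)
  distinctα i {m} {m′} eq =
    toℕ-injective (+-cancelʳ-≡ (toℕ i * l) _ _ (position-≡ m i m′ i eq))

  distinctβ : ∀ j → Distinct (λ n → entry j n)
  distinctβ j {n} {n′} eq =
    toℕ-injective (*-cancelʳ-≡ _ _ l
      (+-cancelˡ-≡ (toℕ j) _ _ (position-≡ j n j n′ eq)))

  -- (c_{il}, c_{1+il}, …, c_{(l-1)+il})
  Cα : Fin t → Group.Carrier Σ-q
  Cα i = cycle (λ m → entry m i) (distinctα i)

  -- (c_j, c_{j+l}, …, c_{j+(t-1)l})
  Cβ : Fin l → Group.Carrier Σ-q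
  Cβ j = cycle (λ n → entry j n) (distinctβ j)

  α β : Group.Carrier Σ-q
  α = product Σ-q Cα
  β = product Σ-q Cβ

  open Group Σ-q using (_∙_) renaming (_≈_ to _≈ₚ_)

  G : Pred (Group.Carrier Σ-q) (a ⊔ ℓ₁)
  G π = ∃[ i ] ∃[ j ] i ≤ l ∸ 1 × j ≤ t ∸ 1 × π ≈ₚ (power Σ-q α i ∙ power Σ-q β j)

-- In the coordinates x = c_{m+nl}, the permutation αⁱβʲ is the translation
-- (m , n) ↦ (m + i mod l , n + j mod t). Hence G consists of all translations of
-- ℤ/l × ℤ/t, so it is a commutative and transitive group. If π and ρ in such a
-- group agree at x, then they agree at every y = σ x, because
-- π (σ x) = σ (π x) = σ (ρ x) = ρ (σ x). Therefore no element other than the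
-- identity has a fixed point, and π ↦ π x₀ is a bijection onto the q points.

module Submission where

open import Defs
open import Algebra.Apartness.Bundles using (HeytingField)
open import Algebra.Bundles using (Group)
open import Data.Fin.Base using (Fin; zero; suc; toℕ; fromℕ<)
open import Data.Fin.Properties using (toℕ<n; toℕ-injective; toℕ-fromℕ<)
import Data.Fin.Properties as Fin
open import Data.Nat.Base using (ℕ; zero; suc; _+_; _*_; _∸_; _≤_; _<_; _^_; NonZero)
open import Data.Nat.DivMod
  using (_/_; _%_; _mod_; m%n<n; m<n⇒m%n≡m; [m+n]%n≡m%n; [m+kn]%n≡m%n;
         m≡m%n+[m/n]*n; m<n*o⇒m/o<n)
open import Data.Nat.Primality using (Prime; prime⇒nonZero)
open import Data.Nat.Properties
  using (+-assoc; +-comm; m∸n+n≡m; m+[n∸m]≡n;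
         <⇒≤; <⇒≤pred; ≤-trans; pred[n]≤n; m^n≢0; m*n≢0⇒m≢0)
open import Data.Product.Base using (∃-syntax; _×_; _,_; proj₁; proj₂)
open import Data.Vec.Functional using (Vector)
open import Function.Base using (_∘_)
open import Function.Bundles using (Inverse)
open import Level using (Level)
open import Relation.Binary.Bundles using (Setoid)
open import Relation.Binary.Definitions using (Decidable)
open import Relation.Binary.PropositionalEquality as ≡ using (_≡_; _≢_)
open import Relation.Unary using (Pred; _∈_)

private
  variable
    a ℓ ℓ₁ ℓ₂ b : Level

-- Rotations of the cyclic group of residues modulo `k`.

module _ {k : ℕ} .{{_ : NonZero k}} where

  rotate : ℕ → Fin k → Fin k
  rotate i m = (i + toℕ m) mod k

  toℕ-rotate : ∀ i m → toℕ (rotate i m) ≡ (i + toℕ m) % k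
  toℕ-rotate i m = toℕ-mod (i + toℕ m) k

  rotate-zero : ∀ m → rotate 0 m ≡ m
  rotate-zero m = toℕ-injective (≡.trans (toℕ-rotate 0 m) (m<n⇒m%n≡m (toℕ<n m)))

  rotate-+ : ∀ i j m → rotate (i + j) m ≡ rotate i (rotate j m)
  rotate-+ i j m = toℕ-injective (begin
    toℕ (rotate (i + j) m)        ≡⟨ toℕ-rotate (i + j) m ⟩
    (i + j + toℕ m) % k           ≡⟨ ≡.cong (_% k) (+-assoc i j (toℕ m)) ⟩
    (i + (j + toℕ m)) % k         ≡⟨ absorbˡ i (j + toℕ m) k ⟨
    (i + (j + toℕ m) % k) % k     ≡⟨ ≡.cong (λ z → (i + z) % k) (toℕ-rotate j m) ⟨
    (i + toℕ (rotate j m)) % k    ≡⟨ toℕ-rotate i (rotate j m) ⟨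
    toℕ (rotate i (rotate j m))   ∎)
    where open ≡.≡-Reasoning

  rotate-comm : ∀ i j m → rotate i (rotate j m) ≡ rotate j (rotate i m)
  rotate-comm i j m = begin
    rotate i (rotate j m)   ≡⟨ rotate-+ i j m ⟨
    rotate (i + j) m        ≡⟨ ≡.cong (λ z → rotate z m) (+-comm i j) ⟩
    rotate (j + i) m        ≡⟨ rotate-+ j i m ⟩
    rotate j (rotate i m)   ∎
    where open ≡.≡-Reasoning

  -- Lets an arbitrary exponent be brought below the bound demanded by membership in `G`.
  rotate-% : ∀ i m → rotate (i % k) m ≡ rotate i m
  rotate-% i m = toℕ-injective (begin
    toℕ (rotate (i % k) m)   ≡⟨ toℕ-rotate (i % k) m ⟩
    (i % k + toℕ m) % k      ≡⟨ ≡.cong (_% k) (+-comm (i % k) (toℕ m)) ⟩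
    (toℕ m + i % k) % k      ≡⟨ absorbˡ (toℕ m) i k ⟩
    (toℕ m + i) % k          ≡⟨ ≡.cong (_% k) (+-comm (toℕ m) i) ⟩
    (i + toℕ m) % k          ≡⟨ toℕ-rotate i m ⟨
    toℕ (rotate i m)         ∎)
    where open ≡.≡-Reasoning

  rotate-transitive : ∀ m m′ → ∃[ i ] rotate i m ≡ m′
  rotate-transitive m m′ = i , toℕ-injective (begin
    toℕ (rotate i m)                       ≡⟨ toℕ-rotate i m ⟩
    (toℕ m′ + (k ∸ toℕ m) + toℕ m) % k     ≡⟨ ≡.cong (_% k) (+-assoc (toℕ m′) _ _) ⟩
    (toℕ m′ + ((k ∸ toℕ m) + toℕ m)) % k   ≡⟨ ≡.cong (λ z → (toℕ m′ + z) % k) (m∸n+n≡m (<⇒≤ (toℕ<n m))) ⟩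
    (toℕ m′ + k) % k                       ≡⟨ [m+n]%n≡m%n (toℕ m′) k ⟩
    toℕ m′ % k                             ≡⟨ m<n⇒m%n≡m (toℕ<n m′) ⟩
    toℕ m′                                 ∎)
    where
    open ≡.≡-Reasoning
    i : ℕ
    -- This is m′ - m modulo `k`; the truncated subtraction is exact because m < k.
    i = toℕ m′ + (k ∸ toℕ m)

  rotate-inverse : ∀ {i} → i ≤ k → ∀ m → rotate i (rotate (k ∸ i) m) ≡ m
  rotate-inverse {i} i≤k m = toℕ-injective (begin
    toℕ (rotate i (rotate (k ∸ i) m))   ≡⟨ ≡.cong toℕ (rotate-+ i (k ∸ i) m) ⟨
    toℕ (rotate (i + (k ∸ i)) m)        ≡⟨ ≡.cong (λ z → toℕ (rotate z m)) (m+[n∸m]≡n i≤k) ⟩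
    toℕ (rotate k m)                    ≡⟨ toℕ-rotate k m ⟩
    (k + toℕ m) % k                     ≡⟨ ≡.cong (_% k) (+-comm k (toℕ m)) ⟩
    (toℕ m + k) % k                     ≡⟨ [m+n]%n≡m%n (toℕ m) k ⟩
    toℕ m % k                           ≡⟨ m<n⇒m%n≡m (toℕ<n m) ⟩
    toℕ m                               ∎)
    where open ≡.≡-Reasoning

next-rotate : ∀ {k} .{{_ : NonZero k}} i (m : Fin k) → next (rotate i m) ≡ rotate (suc i) m
next-rotate {suc n} i m = toℕ-injective (begin
  -- Once `k` is matched as `suc n`, `next` unfolds to `rotate 1`.
  toℕ (next (rotate i m))           ≡⟨ toℕ-rotate 1 (rotate i m) ⟩
  suc (toℕ (rotate i m)) % suc n    ≡⟨ toℕ-rotate 1 (rotate i m) ⟨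
  toℕ (rotate 1 (rotate i m))       ≡⟨ ≡.cong toℕ (rotate-+ 1 i m) ⟨
  toℕ (rotate (suc i) m)            ∎)
  where open ≡.≡-Reasoning

-- Products and powers of disjoint cycles.

module _ (S : Setoid a ℓ) where
  open Setoid S
  open Inverse using (to; to-cong)
  open Group (Symmetric S) using (_∙_; ε) renaming (Carrier to Perm; _≈_ to _≈ₚ_)

  product-fixes : ∀ {n} (πs : Vector Perm n) {x} → (∀ i → to (πs i) x ≈ x) →
                  to (product (Symmetric S) πs) x ≈ x
  product-fixes {zero}  πs fix = refl
  product-fixes {suc n} πs fix =
    trans (to-cong (πs zero) (product-fixes (πs ∘ suc) (fix ∘ suc))) (fix zero)

  -- The rightmost factor acts first: the factors after `k` leave `x` alone, the `k`-th takes it to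
  -- `y`, and the factors before `k` then leave `y` alone.
  product-moves : ∀ {n} (πs : Vector Perm n) k {x y} → to (πs k) x ≈ y →
                  (∀ i → i ≢ k → to (πs i) x ≈ x) →
                  (∀ i → i ≢ k → to (πs i) y ≈ y) →
                  to (product (Symmetric S) πs) x ≈ y
  product-moves πs zero    move fix-x fix-y =
    trans (to-cong (πs zero) (product-fixes (πs ∘ suc) (λ i → fix-x (suc i) λ ()))) move
  product-moves πs (suc k) move fix-x fix-y =
    trans (to-cong (πs zero) (product-moves (πs ∘ suc) k move
            (λ i i≢k → fix-x (suc i) (i≢k ∘ Fin.suc-injective))
            (λ i i≢k → fix-y (suc i) (i≢k ∘ Fin.suc-injective))))
          (fix-y zero λ ())

  module _ (_≟_ : Decidable _≈_) where
    open Cycle S _≟_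

    -- Both the point and its successor lie on the `i`-th cycle, so by disjointness every other
    -- factor fixes both.
    product-disjoint-cycles :
      ∀ {n k} (u : Fin n → Vector Carrier k) (distinct : ∀ i → Distinct (u i)) →
      (∀ {i j m m′} → u i m ≈ u j m′ → i ≡ j) →
      ∀ i m → to (product (Symmetric S) (λ j → cycle (u j) (distinct j))) (u i m) ≈ u i (next m)
    product-disjoint-cycles u distinct disjoint i m =
      product-moves (λ j → cycle (u j) (distinct j)) i
        (shift-entry (u i) (distinct i) next m refl) (fixes m) (fixes (next m))
      where
      fixes : ∀ m j → j ≢ i → to (cycle (u j) (distinct j)) (u i m) ≈ u i m
      fixes m j j≢i = shift-other (u j) (distinct j) next (λ (_ , eq) → j≢i (disjoint eq))

  power-rotates : ∀ {k} .{{_ : NonZero k}} π (v : Vector Carrier k) →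
                  (∀ m → to π (v m) ≈ v (next m)) →
                  ∀ i m → to (power (Symmetric S) π i) (v m) ≈ v (rotate i m)
  power-rotates π v step zero    m = reflexive (≡.cong v (≡.sym (rotate-zero m)))
  power-rotates π v step (suc i) m =
    trans (to-cong π (power-rotates π v step i m))
          (trans (step (rotate i m)) (reflexive (≡.cong v (next-rotate i m))))

  -- Commutative transitive sets of permutations.

  module CommutativeTransitive
    {H : Pred Perm b}
    (comm : ∀ {π ρ} → π ∈ H → ρ ∈ H → (π ∙ ρ) ≈ₚ (ρ ∙ π))
    (transitive : ∀ x y → ∃[ π ] π ∈ H × to π x ≈ y)
    where

    semiregular : ∀ {π ρ x} → π ∈ H → ρ ∈ H → to π x ≈ to ρ x → π ≈ₚ ρ
    semiregular {π} {ρ} {x} π∈H ρ∈H πx≈ρx y with transitive x y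
    ... | σ , σ∈H , σx≈y = begin
      to π y          ≈⟨ to-cong π σx≈y ⟨
      to π (to σ x)   ≈⟨ comm π∈H σ∈H x ⟩
      to σ (to π x)   ≈⟨ to-cong σ πx≈ρx ⟩
      to σ (to ρ x)   ≈⟨ comm σ∈H ρ∈H x ⟩
      to ρ (to σ x)   ≈⟨ to-cong ρ σx≈y ⟩
      to ρ y          ∎
      where open import Relation.Binary.Reasoning.Setoid S

    -- A fixed point is a point of agreement with `ε`.
    withoutFixedPoints : ε ∈ H → WithoutFixedPoints S H
    withoutFixedPoints ε∈H π∈H π≉ε (_ , πx≈x) = π≉ε (semiregular π∈H ε∈H πx≈x)

    hasOrder : ∀ {n} → Inverse (≡.setoid (Fin n)) S → Carrier → HasOrder (Symmetric S) H n
    hasOrder enumeration x₀ = record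
      { to        = λ i → let π , π∈H , _ = transitive x₀ (point i) in π , π∈H
      ; from      = λ (π , _) → index (to π x₀)
      ; to-cong   = λ { ≡.refl _ → refl }
      ; from-cong = λ π≈ρ → index-cong (π≈ρ x₀)
      ; inverse   =
          -- The element chosen for the label of `π` agrees with `π` at `x₀`, hence everywhere.
          (λ { {π , π∈H} ≡.refl → let _ , ρ∈H , ρx₀≈ = transitive x₀ (point (index (to π x₀))) in
               semiregular ρ∈H π∈H (trans ρx₀≈ (point-index (to π x₀))) })
        , (λ {i} π≈ → let _ , _ , ρx₀≈ = transitive x₀ (point i) in
             ≡.trans (index-cong (trans (π≈ x₀) ρx₀≈)) (index-point i))
      }
      where
      open Inverse enumeration using () renaming
        ( to to point; from to index; from-cong to index-cong
        ; strictlyInverseˡ to point-index; strictlyInverseʳ to index-point)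

-- Coordinates on the field and translations.

module _ (F : HeytingField a ℓ₁ ℓ₂) {p r e : ℕ} (p-prime : Prime p) (e≤r : e ≤ r)
  (enumeration : Enumeration F (p ^ r))
  where

  open HeytingField F using (_≈_; sym; trans; reflexive)
  open Construction F p-prime e≤r enumeration
  open Inverse using (to; to-cong; from-cong; strictlyInverseʳ)
  open Inverse enumeration using () renaming
    (to to c; from to index; strictlyInverseˡ to c-index)
  open Group Σ-q using (_∙_; ε; _⁻¹) renaming (Carrier to Perm; _≈_ to _≈ₚ_)

  instance
    t-nonZero : NonZero t
    t-nonZero = m*n≢0⇒m≢0 t {{≡.subst NonZero (≡.sym t*l≡q) (m^n≢0 p r {{prime⇒nonZero p-prime}})}}

  -- The position m + n l has residue m modulo `l`; once m is known, distinctness along a single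
  -- cycle of `β` gives n.
  entry-injective : ∀ m n m′ n′ → entry m n ≈ entry m′ n′ → m ≡ m′ × n ≡ n′
  entry-injective m n m′ n′ eq = m≡m′ , distinctβ m′ (≡.subst (λ z → entry z n ≈ _) m≡m′ eq)
    where
    open ≡.≡-Reasoning
    position-% : ∀ (m : Fin l) (n : Fin t) → (toℕ m + toℕ n * l) % l ≡ toℕ m
    position-% m n = ≡.trans ([m+kn]%n≡m%n (toℕ m) (toℕ n) l) (m<n⇒m%n≡m (toℕ<n m))
    m≡m′ : m ≡ m′
    m≡m′ = toℕ-injective (begin
      toℕ m                        ≡⟨ position-% m n ⟨
      (toℕ m + toℕ n * l) % l      ≡⟨ ≡.cong (_% l) (position-≡ m n m′ n′ eq) ⟩
      (toℕ m′ + toℕ n′ * l) % l    ≡⟨ position-% m′ n′ ⟩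
      toℕ m′                       ∎)

  -- Euclidean division of the index by `l`; the quotient is below `t` because the index is below q
  -- = t l.
  entry-surjective : ∀ x → ∃[ m ] ∃[ n ] entry m n ≈ x
  entry-surjective x = y mod l , fromℕ< y/l<t ,
    trans (reflexive (≡.cong c (toℕ-injective (begin
      toℕ (fromℕ< (position< (y mod l) (fromℕ< y/l<t)))   ≡⟨ toℕ-fromℕ< _ ⟩
      toℕ (y mod l) + toℕ (fromℕ< y/l<t) * l              ≡⟨ ≡.cong₂ (λ m n → m + n * l) (toℕ-mod y l) (toℕ-fromℕ< y/l<t) ⟩
      y % l + y / l * l                                   ≡⟨ m≡m%n+[m/n]*n y l ⟨
      y                                                   ∎)))) (c-index x)
    where
    open ≡.≡-Reasoning
    y : ℕ
    y = toℕ (index x)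
    y/l<t : y / l < t
    y/l<t = m<n*o⇒m/o<n (≡.subst (y <_) (≡.sym t*l≡q) (toℕ<n (index x)))

  -- The exponents are unbounded naturals, so sums and complements can be used as they stand and
  -- reduced only when membership in `G` is concluded.
  Translates : Perm → ℕ → ℕ → Set _
  Translates π i j = ∀ m n → to π (entry m n) ≈ entry (rotate i m) (rotate j n)

  entry-cong : ∀ {m m′ n n′} → m ≡ m′ → n ≡ n′ → entry m n ≈ entry m′ n′
  entry-cong m≡m′ n≡n′ = reflexive (≡.cong₂ entry m≡m′ n≡n′)

  ≈ₚ-on-entries : ∀ {π ρ} → (∀ m n → to π (entry m n) ≈ to ρ (entry m n)) → π ≈ₚ ρ
  ≈ₚ-on-entries {π} {ρ} π≈ρ x with entry-surjective x
  ... | m , n , eq = trans (to-cong π (sym eq)) (trans (π≈ρ m n) (to-cong ρ eq))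

  -- The power of `β` acts first and rotates n with m held fixed; the power of `α` then rotates m
  -- with the new second coordinate held fixed.
  αⁱβʲ-translates : ∀ i j → Translates (power Σ-q α i ∙ power Σ-q β j) i j
  αⁱβʲ-translates i j m n =
    trans (to-cong (power Σ-q α i)
            (power-rotates S β (entry m) (β-entry m) j n))
          (power-rotates S α (λ m → entry m (rotate j n)) (α-entry (rotate j n)) i m)
    where
    S : Setoid _ _
    S = fieldSetoid F
    α-entry : ∀ n m → to α (entry m n) ≈ entry (next m) n
    -- The cycles of `α` are indexed by the second coordinate, so `entry` is transposed and
    -- disjointness comes from the second component of `entry-injective`.
    α-entry = product-disjoint-cycles S _≟_ (λ n m → entry m n) distinctα
      (λ {i} {j} {m} {m′} → proj₂ ∘ entry-injective m i m′ j)
    β-entry : ∀ m n → to β (entry m n) ≈ entry m (next n)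
    β-entry = product-disjoint-cycles S _≟_ entry distinctβ
      (λ {i} {j} {n} {n′} → proj₁ ∘ entry-injective i n j n′)

  ∈G⇒translates : ∀ {π} ((i , j , _) : π ∈ G) → Translates π i j
  ∈G⇒translates (i , j , _ , _ , π≈) m n = trans (π≈ (entry m n)) (αⁱβʲ-translates i j m n)

  -- Rotations depend only on residues, so the exponents may be replaced by their remainders, which
  -- are at most `l ∸ 1` and `t ∸ 1`.
  translates⇒∈G : ∀ {π} i j → Translates π i j → π ∈ G
  translates⇒∈G {π} i j π-translates =
    i % l , j % t , <⇒≤pred (m%n<n i l) , <⇒≤pred (m%n<n j t) ,
    ≈ₚ-on-entries {π} {power Σ-q α (i % l) ∙ power Σ-q β (j % t)} λ m n →
      trans (π-translates m n)
        (trans (entry-cong (≡.sym (rotate-% i m)) (≡.sym (rotate-% j n)))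
               (sym (αⁱβʲ-translates (i % l) (j % t) m n)))

  -- The rotations stay nested so that closure can merge them by `rotate-+` and commutativity can
  -- swap them by `rotate-comm`.
  ∙-translates : ∀ {π ρ i j i′ j′} → Translates π i j → Translates ρ i′ j′ →
                 ∀ m n → to (π ∙ ρ) (entry m n) ≈ entry (rotate i (rotate i′ m)) (rotate j (rotate j′ n))
  ∙-translates {π} π-translates ρ-translates m n =
    trans (to-cong π (ρ-translates m n)) (π-translates _ _)

  -- Closure, commutativity and transitivity of `G`.

  ε∈G : ε ∈ G
  ε∈G = translates⇒∈G {ε} 0 0 λ m n →
    entry-cong (≡.sym (rotate-zero m)) (≡.sym (rotate-zero n))

  G-isSubgroup : IsSubgroup Σ-q G
  G-isSubgroup = record
    { ∈-resp-≈  = λ π≈ρ (i , j , i≤ , j≤ , π≈) → i , j , i≤ , j≤ , λ x → trans (sym (π≈ρ x)) (π≈ x)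
    ; ε-closed  = ε∈G
    ; ∙-closed  = λ {π} {ρ} π∈G@(i , j , _) ρ∈G@(i′ , j′ , _) →
        translates⇒∈G {π ∙ ρ} (i + i′) (j + j′) λ m n →
          trans (∙-translates {π} {ρ} (∈G⇒translates {π} π∈G) (∈G⇒translates {ρ} ρ∈G) m n)
                (entry-cong (≡.sym (rotate-+ i i′ m)) (≡.sym (rotate-+ j j′ n)))
    -- The complements `l ∸ i` and `t ∸ j` stand for -i and -j. Since `π` carries the point so
    -- translated back to `entry m n`, applying the inverse of `π` gives the claim.
    ; ⁻¹-closed = λ {π} π∈G@(i , j , i≤ , j≤ , _) →
        translates⇒∈G {π ⁻¹} (l ∸ i) (t ∸ j) λ m n →
          trans (from-cong π
                  (trans (entry-cong (≡.sym (rotate-inverse (≤-trans i≤ pred[n]≤n) m))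
                                     (≡.sym (rotate-inverse (≤-trans j≤ pred[n]≤n) n)))
                         (sym (∈G⇒translates {π} π∈G _ _))))
                (strictlyInverseʳ π _)
    }

  G-comm : ∀ {π ρ} → π ∈ G → ρ ∈ G → (π ∙ ρ) ≈ₚ (ρ ∙ π)
  G-comm {π} {ρ} π∈G@(i , j , _) ρ∈G@(i′ , j′ , _) =
    ≈ₚ-on-entries {π ∙ ρ} {ρ ∙ π} λ m n →
      trans (∙-translates {π} {ρ} π-translates ρ-translates m n)
        (trans (entry-cong (rotate-comm i i′ m) (rotate-comm j j′ n))
               (sym (∙-translates {ρ} {π} ρ-translates π-translates m n)))
    where
    π-translates : Translates π i j
    π-translates = ∈G⇒translates {π} π∈G
    ρ-translates : Translates ρ i′ j′
    ρ-translates = ∈G⇒translates {ρ} ρ∈G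

  G-transitive : ∀ x y → ∃[ π ] π ∈ G × to π x ≈ y
  G-transitive x y =
    let m  , n  , x≈ = entry-surjective x
        m′ , n′ , y≈ = entry-surjective y
        -- The two coordinates are solved for independently.
        i  , i≡ = rotate-transitive m m′
        j  , j≡ = rotate-transitive n n′
        π = power Σ-q α i ∙ power Σ-q β j
    in  π , translates⇒∈G {π} i j (αⁱβʲ-translates i j) ,
        trans (to-cong π (sym x≈))
          (trans (αⁱβʲ-translates i j m n) (trans (entry-cong i≡ j≡) y≈))

corollary17 : ∀ {a ℓ₁ ℓ₂} (F : HeytingField a ℓ₁ ℓ₂) (p r e : ℕ)
    (p-prime : Prime p) → 1 ≤ e → (e≤r : e ≤ r) →
    (c : Enumeration F (p ^ r)) →
    let open Construction F p-prime e≤r c in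
    IsSubgroup Σ-q G × WithoutFixedPoints (fieldSetoid F) G × HasOrder Σ-q G q
corollary17 F p r e p-prime 1≤e e≤r c =
    G-isSubgroup F p-prime e≤r c
  , (λ {π} → withoutFixedPoints (ε∈G F p-prime e≤r c) {π})
  -- Any point can serve as the base point of the orbit map; zero is at hand in every field.
  , hasOrder c (HeytingField.0# F)
  where
  open Construction F p-prime e≤r c using (G)
  open CommutativeTransitive (fieldSetoid F) {H = G}
    (λ {π} {ρ} → G-comm F p-prime e≤r c {π} {ρ}) (G-transitive F p-prime e≤r c)
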